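{- For every integer $k\geq 2$ there exists a constant $c_k$ such that for any two non-empty finite graphs $G_1$ and $G_2$, \[R(G_1, G_2) \leq \hat{R}^{[k]}(BG_1, BG_2) \leq c_k \cdot R(G_1, G_2)^3.\]
   Context: For a set $R$ of positive integers, an $R$-uniform hypergraph ($R$-graph) is a hypergraph $\mathcal{H}=(V,E)$ with $E\subseteq 2^V$ in which the cardinality of every edge lies in $R$; $[k]=\{1,\dots,k\}$. An $R$-graph $\mathcal{H}$ is covering if every pair of distinct vertices of $\mathcal{H}$ is contained in some edge of $\mathcal{H}$. For a graph $G$, a hypergraph is a Berge-$G$ if there is a bijection $f:E(G)\to E(\mathcal{H})$ with $e\subseteq f(e)$ for all $e\in E(G)$ (where $V(G)$ is identified with a subset of the vertices of the hypergraph); a hypergraph $\mathcal{H}$ contains a blue (resp. red) Berge-$G$ if it has a subhypergraph that is a Berge-$G$ all of whose edges are blue (resp. red), i.e. there is an injection $\varphi:V(G)\to V(\mathcal{H})$ and an injection $f:E(G)\to E(\mathcal{H})$ with $\varphi(e)\subseteq f(e)$ and $f(e)$ of that color for every $e\in E(G)$. The cover Ramsey number $\hat{R}^R(BG_1,BG_2)$ is the smallest integer $n_0$ such that for every covering $R$-graph $\mathcal{H}$ on $n\geq n_0$ vertices and every 2-coloring (blue/red) of the edges of $\mathcal{H}$, there is either a blue Berge-$G_1$ or a red Berge-$G_2$ in $\mathcal{H}$. $R(G_1,G_2)$ denotes the classical two-color Ramsey number: the smallest $n$ such that every blue/red edge-coloring of $K_n$ contains a blue copy of $G_1$ or a red copy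 of $G_2$. -}

module Defs where

open import Data.Nat using (ℕ; _≤_; _<_; _*_; _^_)
open import Data.Fin using (Fin)
open import Data.Fin.Subset using (Subset; _∈_; ∣_∣)
open import Data.Bool using (Bool; true; false)
open import Data.Product using (Σ; _×_; _,_; ∃; proj₁; proj₂)
open import Data.Sum using (_⊎_)
open import Relation.Binary.PropositionalEquality using (_≡_; _≢_)
open import Function.Definitions using (Injective)

data Colour : Set where
  blue red : Colour

record Graph : Set where
  field
    nV    : ℕ
    nE    : ℕ
    end₁  : Fin nE → Fin nV
    end₂  : Fin nE → Fin nV
    loopless : ∀ e → end₁ e ≢ end₂ e
    simple   : ∀ e e' →
               ((end₁ e ≡ end₁ e' × end₂ e ≡ end₂ e') ⊎
                (end₁ e ≡ end₂ e' × end₂ e ≡ end₁ e')) → e ≡ e'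
open Graph public

NonEmpty : Graph → Set
NonEmpty G = 1 ≤ nE G

-- A 2-colouring of the edges of K_n (symmetry is required separately).
KColouring : ℕ → Set
KColouring n = Fin n → Fin n → Colour

Symmetric : ∀ {n} → KColouring n → Set
Symmetric {n} χ = ∀ (x y : Fin n) → χ x y ≡ χ y x

MonoCopy : ∀ {n} → KColouring n → Colour → Graph → Set
MonoCopy {n} χ c G =
  Σ (Fin (nV G) → Fin n) λ φ →
    Injective _≡_ _≡_ φ × (∀ e → χ (φ (end₁ G e)) (φ (end₂ G e)) ≡ c)

RamseyProp : Graph → Graph → ℕ → Set
RamseyProp G₁ G₂ n =
  ∀ (χ : KColouring n) → Symmetric χ → MonoCopy χ blue G₁ ⊎ MonoCopy χ red G₂

IsLeast : (ℕ → Set) → ℕ → Set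
IsLeast P r = P r × (∀ n → P n → r ≤ n)

IsRamseyNumber : Graph → Graph → ℕ → Set
IsRamseyNumber G₁ G₂ = IsLeast (RamseyProp G₁ G₂)

-- [k]-graphs (hypergraphs with edge sizes in {1,…,k}) on vertex set Fin n.
-- Edges are indexed by Fin m; the indexing is injective, so the edge
-- set is a genuine set of subsets.
record KHypergraph (k n : ℕ) : Set where
  field
    m      : ℕ
    edge   : Fin m → Subset n
    edge-inj : Injective _≡_ _≡_ edge
    size-pos : ∀ i → 1 ≤ ∣ edge i ∣
    size-le  : ∀ i → ∣ edge i ∣ ≤ k
open KHypergraph public

Covering : ∀ {k n} → KHypergraph k n → Set
Covering {k} {n} H =
  ∀ (u v : Fin n) → u ≢ v → ∃ λ i → u ∈ edge H i × v ∈ edge H i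

HColouring : ∀ {k n} → KHypergraph k n → Set
HColouring H = Fin (m H) → Colour

MonoBerge : ∀ {k n} (H : KHypergraph k n) → HColouring H → Colour → Graph → Set
MonoBerge {k} {n} H χ c G =
  Σ (Fin (nV G) → Fin n) λ φ →
  Σ (Fin (nE G) → Fin (m H)) λ f →
    Injective _≡_ _≡_ φ × Injective _≡_ _≡_ f ×
    (∀ e → φ (end₁ G e) ∈ edge H (f e) ×
           φ (end₂ G e) ∈ edge H (f e) ×
           χ (f e) ≡ c)

CoverGood : ℕ → Graph → Graph → ℕ → Set
CoverGood k G₁ G₂ n =
  ∀ (H : KHypergraph k n) → Covering H → (χ : HColouring H) →
    MonoBerge H χ blue G₁ ⊎ MonoBerge H χ red G₂

CoverThreshold : ℕ → Graph → Graph → ℕ → Set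
CoverThreshold k G₁ G₂ n₀ = ∀ n → n₀ ≤ n → CoverGood k G₁ G₂ n

IsCoverRamseyNumber : ℕ → Graph → Graph → ℕ → Set
IsCoverRamseyNumber k G₁ G₂ = IsLeast (CoverThreshold k G₁ G₂)

{-# OPTIONS --safe #-}

-- Lower bound: K_n is itself a covering [k]-graph, and its Berge copies are
-- ordinary copies.
--
-- Upper bound: fix for every pair ab an edge E a b of the covering hypergraph
-- H on n ≥ 12 k r³ vertices.  It suffices to find r vertices whose pairs get
-- distinct edges, for then a colouring of H induces one of K_r and
-- monochromatic copies lift to Berge copies.  Call b heavy for a if b ∈ E a z
-- for more than D = n / 4r² vertices z.  Since ∑_b #{z : b ∈ E a z} =
-- ∑_z |E a z| ≤ k n, every a has at most 4 k r² heavy b.  Choose the vertices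
-- greedily: the next z must avoid the chosen vertices, the edges E a b of chosen
-- pairs, the vertices heavy for a chosen a, and, for chosen a, b with b not
-- heavy for a, the at most D vertices z with b ∈ E a z.  This forbids at most
-- r + k r² + 4 k r³ + r² D < n vertices.
--
-- Both numbers are found by bounded search, as both properties are decidable.
module Submission where

open import Defs
open import Data.Bool using (Bool; true; false)
open import Data.Bool.Properties using () renaming (_≟_ to _≟ᵇ_)
open import Data.Fin using (Fin; zero; suc; toℕ; fromℕ<; funToFin; finToFun) renaming (_<_ to _<ᶠ_)
open import Data.Fin.Properties using (any?; all?; toℕ-fromℕ<; injective⇒≤; finToFun-funToFin; 2↔Bool;
  ¬∀⟶∃¬; <-cmp; <-irrefl; <-asym)
  renaming (_≟_ to _≟ᶠ_; _<?_ to _<ᶠ?_; <-trans to <ᶠ-trans; <-irrelevant to <ᶠ-irrelevant)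
open import Data.Fin.Subset using (Subset; _∈_; _∉_; ∣_∣; ⁅_⁆; _∪_; ⊥; ⊤)
open import Data.Fin.Subset.Properties using (_∈?_; anySubset?; x∈⁅x⁆; x∈⁅y⁆⇒x≡y; x∈p∪q⁻; x∈p∪q⁺; ∣p∣≤∣p∪q∣; ∣⁅x⁆∣≡1; ∣⊥∣≡0; ∣⊤∣≡n; p⊆q⇒∣p∣≤∣q∣)
open import Data.List using (List; []; _∷_; length; filter; allFin; cartesianProduct) renaming (lookup to lookupᴸ)
open import Data.List.Membership.Propositional using () renaming (_∈_ to _∈ᴸ_)
open import Data.List.Membership.Propositional.Properties using (∈-lookup; ∈-filter⁺; ∈-filter⁻; ∈-cartesianProduct⁺; ∈-allFin)
open import Data.List.Properties using (length-tabulate)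
open import Data.List.Relation.Unary.All using () renaming (lookup to All-lookup)
open import Data.List.Relation.Unary.All.Properties using (all-filter)
open import Data.List.Relation.Unary.AllPairs using (AllPairs; []; _∷_)
open import Data.List.Relation.Unary.Any using (here; there; index)
open import Data.List.Relation.Unary.Any.Properties using (lookup-index)
open import Data.List.Relation.Unary.Unique.Propositional using (Unique)
open import Data.List.Relation.Unary.Unique.Propositional.Properties using (allFin⁺; cartesianProduct⁺) renaming (filter⁺ to Unique-filter⁺)
open import Data.Nat using (ℕ; zero; suc; _≤_; _<_; _+_; _*_; _^_; _/_; _%_; z≤n; s≤s; z<s; s<s)
open import Data.Nat.DivMod using (m/n*n≤m; m≡m%n+[m/n]*n; m%n<n)
open import Data.Nat.Properties hiding (<-cmp; <-irrefl; <-asym)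
open import Data.Nat.Solver using (module +-*-Solver)
open import Data.Product using (Σ; _×_; _,_; ∃; proj₁; proj₂; swap)
import Data.Product as Product
open import Data.Sum using (_⊎_; inj₁; inj₂; [_,_]′)
import Data.Sum as Sum
open import Data.Vec using ([]; _∷_; lookup; tabulate)
import Data.Vec.Functional as F
open import Data.Vec.Properties using (≡-dec; tabulate∘lookup; tabulate-cong; lookup∘tabulate; lookup⇒[]=; []=⇒lookup)
open import Function using (_∘_; Inverse)
open import Function.Definitions using (Injective)
open import Level using (0ℓ)
open import Relation.Binary.Core using (Rel)
open import Relation.Binary.Definitions using (Reflexive; _Respects_; tri<; tri≈; tri>) renaming (Symmetric to Symmetricᵇ)
open import Relation.Binary.PropositionalEquality using (_≡_; _≢_; _≗_; refl; sym; trans; cong; cong₂; subst)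
open import Relation.Nullary using (Dec; yes; no; does; contradiction)
open import Relation.Nullary.Decidable using (map′; _×-dec_; _⊎-dec_; _→-dec_; ¬?; decidable-stable; dec-true)
open import Relation.Unary using (Decidable)
open import Algebra.Properties.CommutativeMonoid.Sum +-0-commutativeMonoid using (sum; sum-cong-≗; ∑-comm)

-- Decidability

-- Functions are searched only up to pointwise equality, so the predicates
-- have to respect it.
Searchable : {A : Set} → Rel A 0ℓ → Set₁
Searchable {A} _≈_ = {P : A → Set} → P Respects _≈_ → Decidable P → Dec (∃ P)

Pointwise : {A : Set} → Rel A 0ℓ → ∀ n → Rel (Fin n → A) 0ℓ
Pointwise _≈_ n f g = ∀ i → f i ≈ g i

-- A universal statement is decided by searching for a counterexample. Symmetry of `≈` is what makes
-- the negated predicate respect `≈` as well.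
search-all : {A : Set} {_≈_ : Rel A 0ℓ} → Searchable _≈_ → Symmetricᵇ _≈_ →
             {P : A → Set} → P Respects _≈_ → Decidable P → Dec (∀ x → P x)
search-all search ≈-sym resp P?
  with search (λ x≈y ¬Px Py → ¬Px (resp (≈-sym x≈y) Py)) (λ x → ¬? (P? x))
... | yes (x , ¬Px) = no λ ∀P → ¬Px (∀P x)
... | no ∄¬P = yes λ x → decidable-stable (P? x) λ ¬Px → ∄¬P (x , ¬Px)

search-Fin : ∀ {n} → Searchable (_≡_ {A = Fin n})
search-Fin _ = any?

search-Subset : ∀ {n} → Searchable (_≡_ {A = Subset n})
search-Subset _ = anySubset?

search-Colour : Searchable (_≡_ {A = Colour})
search-Colour _ P? = map′
  (λ { (inj₁ p) → blue , p ; (inj₂ p) → red , p })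
  (λ { (blue , p) → inj₁ p ; (red , p) → inj₂ p })
  (P? blue ⊎-dec P? red)

-- Induction on the size of the domain: search for the value at `zero`, then for the rest. A
-- function agrees with its reassembly `f zero F.∷ f ∘ suc` only pointwise, which is where `resp`
-- enters.
search-→ : {A : Set} {_≈_ : Rel A 0ℓ} → Reflexive _≈_ → Searchable _≈_ →
           ∀ {n} → Searchable (Pointwise _≈_ n)
search-→ ≈-refl search {zero} resp P? =
  map′ (λ p → F.[] , p) (λ (_ , p) → resp (λ ()) p) (P? F.[])
search-→ ≈-refl search {suc n} resp P? = map′
  (λ (a , f , p) → (a F.∷ f) , p)
  (λ (f , p) → f zero , f ∘ suc , resp (λ { zero → ≈-refl ; (suc i) → ≈-refl }) p)
  (search (λ a≈b (f , p) → f , resp (λ { zero → a≈b ; (suc i) → ≈-refl }) p)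
    λ a → search-→ ≈-refl search
      (λ f≈g → resp (λ { zero → ≈-refl ; (suc i) → f≈g i })) (λ f → P? (a F.∷ f)))

_≟ᶜ_ : (c d : Colour) → Dec (c ≡ d)
blue ≟ᶜ blue = yes refl
blue ≟ᶜ red  = no λ ()
red  ≟ᶜ blue = no λ ()
red  ≟ᶜ red  = yes refl

injective? : ∀ {n} {A : Set} → ((x y : A) → Dec (x ≡ y)) →
             (f : Fin n → A) → Dec (Injective _≡_ _≡_ f)
injective? _≟_ f = map′ (λ inj {i} {j} → inj i j) (λ inj i j → inj)
  (all? λ i → all? λ j → (f i ≟ f j) →-dec (i ≟ᶠ j))

injective-resp : ∀ {n} {A : Set} {f g : Fin n → A} → f ≗ g →
                 Injective _≡_ _≡_ f → Injective _≡_ _≡_ g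
injective-resp f≗g inj {i} {j} gi≡gj = inj (trans (f≗g i) (trans gi≡gj (sym (f≗g j))))

monoCopy? : ∀ {n} (χ : KColouring n) c G → Dec (MonoCopy χ c G)
monoCopy? χ c G = search-→ refl search-Fin
  (λ φ≗ψ (inj , mono) → injective-resp φ≗ψ inj ,
    λ e → trans (sym (cong₂ χ (φ≗ψ _) (φ≗ψ _))) (mono e))
  (λ φ → injective? _≟ᶠ_ φ ×-dec all? λ e → χ _ _ ≟ᶜ c)

ramseyProp? : ∀ G₁ G₂ n → Dec (RamseyProp G₁ G₂ n)
ramseyProp? G₁ G₂ n = search-all
  (search-→ (λ _ → refl) (search-→ refl search-Colour))
  (λ χ≈χ′ i j → sym (χ≈χ′ i j))
  (λ {χ} {χ′} χ≈χ′ prop χ′-sym → Sum.map (resp {χ} {χ′} {G = G₁} χ≈χ′) (resp {χ} {χ′} {G = G₂} χ≈χ′)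
    (prop λ x y → trans (χ≈χ′ x y) (trans (χ′-sym x y) (sym (χ≈χ′ y x)))))
  (λ χ → (all? λ x → all? λ y → χ x y ≟ᶜ χ y x)
    →-dec (monoCopy? χ blue G₁ ⊎-dec monoCopy? χ red G₂))
  where
  resp : ∀ {χ χ′ : KColouring n} {c G} → (∀ x y → χ x y ≡ χ′ x y) → MonoCopy χ c G → MonoCopy χ′ c G
  resp χ≈χ′ (φ , inj , mono) = φ , inj , λ e → trans (sym (χ≈χ′ _ _)) (mono e)

module _ {m n : ℕ} where

  -- The conditions on a covering `KHypergraph`, unbundled with the number of edges fixed, so that
  -- the edge map becomes a function on `Fin m` open to search.
  IsCovering : ℕ → (Fin m → Subset n) → Set
  IsCovering k edge = Injective _≡_ _≡_ edge × (∀ i → 1 ≤ ∣ edge i ∣) × (∀ i → ∣ edge i ∣ ≤ k) ×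
    (∀ u v → u ≢ v → ∃ λ i → u ∈ edge i × v ∈ edge i)

  HasBerge : (Fin m → Subset n) → (Fin m → Colour) → Colour → Graph → Set
  HasBerge edge χ c G =
    Σ (Fin (nV G) → Fin n) λ φ →
    Σ (Fin (nE G) → Fin m) λ f →
      Injective _≡_ _≡_ φ × Injective _≡_ _≡_ f ×
      (∀ e → φ (end₁ G e) ∈ edge (f e) × φ (end₂ G e) ∈ edge (f e) × χ (f e) ≡ c)

  isCovering? : ∀ k edge → Dec (IsCovering k edge)
  isCovering? k edge = injective? (≡-dec _≟ᵇ_) edge
    ×-dec (all? λ i → 1 ≤? ∣ edge i ∣)
    ×-dec (all? λ i → ∣ edge i ∣ ≤? k)
    ×-dec (all? λ u → all? λ v → ¬? (u ≟ᶠ v) →-dec any? λ i → (u ∈? edge i) ×-dec (v ∈? edge i))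

  isCovering-resp : ∀ {k edge edge′} → edge ≗ edge′ → IsCovering k edge → IsCovering k edge′
  isCovering-resp {k} eq (inj , pos , le , cov) =
    injective-resp eq inj ,
    (λ i → subst (λ p → 1 ≤ ∣ p ∣) (eq i) (pos i)) ,
    (λ i → subst (λ p → ∣ p ∣ ≤ k) (eq i) (le i)) ,
    λ u v u≢v → let i , u∈ , v∈ = cov u v u≢v in
      i , subst (u ∈_) (eq i) u∈ , subst (v ∈_) (eq i) v∈

  hasBerge? : ∀ edge χ c G → Dec (HasBerge edge χ c G)
  hasBerge? edge χ c G = search-→ refl search-Fin
    (λ φ≗ψ (f , φ-inj , f-inj , p) → f , injective-resp φ≗ψ φ-inj , f-inj , λ e →
      let p₁ , p₂ , q = p e in
      subst (_∈ edge (f e)) (φ≗ψ _) p₁ , subst (_∈ edge (f e)) (φ≗ψ _) p₂ , q)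
    λ φ → search-→ refl search-Fin
      (λ f≗g (φ-inj , f-inj , p) → φ-inj , injective-resp f≗g f-inj , λ e →
        subst (λ i → φ (end₁ G e) ∈ edge i × φ (end₂ G e) ∈ edge i × χ i ≡ c) (f≗g e) (p e))
      λ f → injective? _≟ᶠ_ φ ×-dec injective? _≟ᶠ_ f ×-dec
        all? λ e → (_ ∈? _) ×-dec (_ ∈? _) ×-dec (_ ≟ᶜ c)

  hasBerge-resp : ∀ {edge edge′ χ χ′ c G} → edge ≗ edge′ → χ ≗ χ′ →
                  HasBerge edge χ c G → HasBerge edge′ χ′ c G
  hasBerge-resp {c = c} eq eqχ (φ , f , φ-inj , f-inj , p) = φ , f , φ-inj , f-inj , λ e →
    let p₁ , p₂ , q = p e in
    subst (_ ∈_) (eq (f e)) p₁ , subst (_ ∈_) (eq (f e)) p₂ , trans (sym (eqχ (f e))) q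

  EveryColouring : ℕ → Graph → Graph → (Fin m → Subset n) → Set
  EveryColouring k G₁ G₂ edge =
    IsCovering k edge → ∀ χ → HasBerge edge χ blue G₁ ⊎ HasBerge edge χ red G₂

  everyColouring? : ∀ k G₁ G₂ edge → Dec (EveryColouring k G₁ G₂ edge)
  everyColouring? k G₁ G₂ edge = isCovering? k edge →-dec
    search-all (search-→ refl search-Colour) (λ eq i → sym (eq i))
      (λ eq → Sum.map (hasBerge-resp {G = G₁} (λ i → refl {x = edge i}) eq)
                      (hasBerge-resp {G = G₂} (λ i → refl {x = edge i}) eq))
      (λ χ → hasBerge? edge χ blue G₁ ⊎-dec hasBerge? edge χ red G₂)

-- The characteristic function read as a binary numeral; its injectivity bounds the number of edges
-- of a hypergraph on n vertices.
subset-code : ∀ {n} → Subset n → Fin (2 ^ n)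
subset-code p = funToFin (Inverse.from 2↔Bool ∘ lookup p)

subset-code-injective : ∀ {n} → Injective _≡_ _≡_ (subset-code {n})
subset-code-injective {n} {p} {q} eq =
  trans (sym (tabulate∘lookup p)) (trans (tabulate-cong pointwise) (tabulate∘lookup q))
  where
  pointwise : lookup p ≗ lookup q
  pointwise i = trans (sym (Inverse.strictlyInverseˡ 2↔Bool (lookup p i)))
    (trans (cong (Inverse.to 2↔Bool) code-eq) (Inverse.strictlyInverseˡ 2↔Bool (lookup q i)))
    where
    code-eq : Inverse.from 2↔Bool (lookup p i) ≡ Inverse.from 2↔Bool (lookup q i)
    code-eq = trans (sym (finToFun-funToFin {n} _ i))
      (trans (cong (λ c → finToFun {2} {n} c i) eq) (finToFun-funToFin {n} _ i))

-- Distinct edges have distinct codes, so m is at most `2 ^ n`; for each such m there are finitely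
-- many edge maps and colourings to check.
coverGood? : ∀ k G₁ G₂ n → Dec (CoverGood k G₁ G₂ n)
coverGood? k G₁ G₂ n = map′ to from (all? λ b → everyEdge? (toℕ b))
  where
  EveryEdge : ℕ → Set
  EveryEdge m = (edge : Fin m → Subset n) → EveryColouring k G₁ G₂ edge

  everyEdge? : ∀ m → Dec (EveryEdge m)
  everyEdge? m = search-all (search-→ refl search-Subset) (λ eq i → sym (eq i))
    (λ eq good cov χ → Sum.map (hasBerge-resp {G = G₁} eq (λ i → refl {x = χ i}))
                               (hasBerge-resp {G = G₂} eq (λ i → refl {x = χ i}))
      (good (isCovering-resp (λ i → sym (eq i)) cov) χ))
    (everyColouring? k G₁ G₂)

  to : (∀ (b : Fin (suc (2 ^ n))) → EveryEdge (toℕ b)) → CoverGood k G₁ G₂ n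
  to good H cov χ =
    subst EveryEdge (toℕ-fromℕ< m<) (good (fromℕ< m<)) (edge H)
      ((λ {i} {j} → edge-inj H {i} {j}) , size-pos H , size-le H , cov) χ
    where
    m< : m H < suc (2 ^ n)
    m< = s≤s (injective⇒≤ (λ {i} {j} eq → edge-inj H (subset-code-injective eq)))

  from : CoverGood k G₁ G₂ n → ∀ (b : Fin (suc (2 ^ n))) → EveryEdge (toℕ b)
  from good b edge (inj , pos , le , cov) χ = good
    (record { edge = edge ; edge-inj = inj ; size-pos = pos ; size-le = le }) cov χ

-- Least elements and least thresholds

least : {P : ℕ → Set} → Decidable P → ∀ n → P n → ∃ (IsLeast P)
least P? zero P0 = zero , P0 , λ _ _ → z≤n
least {P} P? (suc n) Pn with P? zero
... | yes P0 = zero , P0 , λ _ _ → z≤n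
... | no ¬P0 with least (P? ∘ suc) n Pn
...   | m , Pm , min = suc m , Pm , λ where
        zero P0 → contradiction P0 ¬P0
        (suc l) Pl → s≤s (min l Pl)

-- Being a threshold quantifies over infinitely many n, so it is not tested directly. From a known
-- threshold one descends as long as `P` holds just below; the first failure rules out every smaller
-- threshold.
least-threshold : {P : ℕ → Set} → Decidable P → ∀ N → (∀ n → N ≤ n → P n) →
                  ∃ λ h → IsLeast (λ N → ∀ n → N ≤ n → P n) h × h ≤ N
least-threshold P? zero above = zero , (above , λ _ _ → z≤n) , z≤n
least-threshold {P} P? (suc N) above with P? N
... | no ¬PN = suc N , (above , minimal) , ≤-refl
  where
  minimal : ∀ M → (∀ n → M ≤ n → P n) → suc N ≤ M
  minimal M aboveM with suc N ≤? M
  ... | yes le = le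
  ... | no ≰ = contradiction (aboveM N (≤-pred (≰⇒> ≰))) ¬PN
... | yes PN = let h , isLeast , h≤N = least-threshold P? N above′ in
               h , isLeast , m≤n⇒m≤1+n h≤N
  where
  above′ : ∀ n → N ≤ n → P n
  above′ n N≤n with m≤n⇒m<n∨m≡n N≤n
  ... | inj₁ N<n = above n N<n
  ... | inj₂ refl = PN

-- Ramsey's theorem

injective-from-< : ∀ {n} {A : Set} {f : Fin n → A} → (∀ {i j} → i <ᶠ j → f i ≢ f j) →
                   Injective _≡_ _≡_ f
injective-from-< distinct {i} {j} eq with <-cmp i j
... | tri< i<j _ _ = contradiction eq (distinct i<j)
... | tri≈ _ i≡j _ = i≡j
... | tri> _ _ j<i = contradiction (sym eq) (distinct j<i)

length-filter-split : {A : Set} {P : A → Set} (P? : Decidable P) (xs : List A) →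
  length (filter P? xs) + length (filter (¬? ∘ P?) xs) ≡ length xs
length-filter-split P? [] = refl
length-filter-split P? (x ∷ xs) with P? x
... | yes _ = cong suc (length-filter-split P? xs)
... | no _  = trans (+-suc _ _) (cong suc (length-filter-split P? xs))

≢blue⇒red : ∀ {c} → c ≢ blue → c ≡ red
≢blue⇒red {blue} c≢ = contradiction refl c≢
≢blue⇒red {red} _ = refl

-- Colours are prescribed only for `i <ᶠ j`, so the induction works without symmetry of `χ`, which
-- enters in `clique⇒monoCopy`.
Clique : {A : Set} → (A → A → Colour) → Colour → ℕ → List A → Set
Clique {A} χ c a xs = Σ (Fin a → A) λ φ → (∀ i → φ i ∈ᴸ xs) ×
  (∀ {i j} → i <ᶠ j → φ i ≢ φ j × χ (φ i) (φ j) ≡ c)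

module _ {A : Set} (χ : A → A → Colour) where

  clique-⊆ : ∀ {c a xs ys} → (∀ {x} → x ∈ᴸ xs → x ∈ᴸ ys) → Clique χ c a xs → Clique χ c a ys
  clique-⊆ sub (φ , mem , mono) = φ , sub ∘ mem , mono

  clique-∷ : ∀ {c a x xs ys} → (∀ {y} → y ∈ᴸ ys → y ∈ᴸ xs × x ≢ y × χ x y ≡ c) →
             Clique χ c a ys → Clique χ c (suc a) (x ∷ xs)
  clique-∷ {c} {a} {x} {xs} nbr (φ , mem , mono) = (x F.∷ φ) , mem′ , λ {i} {j} → mono′ i j
    where
    mem′ : ∀ i → (x F.∷ φ) i ∈ᴸ x ∷ xs
    mem′ zero = here refl
    mem′ (suc i) = there (proj₁ (nbr (mem i)))

    mono′ : ∀ i j → i <ᶠ j → (x F.∷ φ) i ≢ (x F.∷ φ) j × χ ((x F.∷ φ) i) ((x F.∷ φ) j) ≡ c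
    mono′ zero (suc j) _ = proj₂ (nbr (mem j))
    mono′ (suc i) (suc j) (s<s i<j) = mono i<j

  -- Remove the first vertex `x` and split the others by their colour towards `x`. One class has at
  -- least half the required size, and a clique of that colour inside it extends by `x`.
  ramsey-cliques : ∀ a b (xs : List A) → Unique xs → 2 ^ (a + b) ≤ length xs →
                   Clique χ blue a xs ⊎ Clique χ red b xs
  ramsey-cliques zero b xs _ _ = inj₁ (F.[] , (λ ()) , λ {})
  ramsey-cliques (suc a) zero xs _ _ = inj₂ (F.[] , (λ ()) , λ {})
  ramsey-cliques (suc a) (suc b) [] _ le =
    contradiction (≤-trans (m^n>0 2 (suc a + suc b)) le) λ ()
  ramsey-cliques (suc a) (suc b) (x ∷ xs) (x≢ ∷ uniq) le =
    [ fromBlue , fromRed ]′ split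
    where
    blue? : Decidable (λ y → χ x y ≡ blue)
    blue? y = χ x y ≟ᶜ blue

    Bs Rs : List A
    Bs = filter blue? xs
    Rs = filter (¬? ∘ blue?) xs

    M : ℕ
    M = 2 ^ (a + suc b)

    split : M ≤ length Bs ⊎ M ≤ length Rs
    split with M ≤? length Bs | M ≤? length Rs
    ... | yes p | _ = inj₁ p
    ... | no _ | yes q = inj₂ q
    -- Two classes smaller than `M` give `2 + length xs ≤ 2 * M`, while `le` says that `2 * M` is at
    -- most `1 + length xs`.
    ... | no p | no q = contradiction le (<⇒≱ (begin
      2 + length xs                     ≡⟨ cong (2 +_) (sym (length-filter-split blue? xs)) ⟩
      2 + (length Bs + length Rs)       ≡⟨ cong suc (sym (+-suc _ _)) ⟩
      suc (length Bs) + suc (length Rs) ≤⟨ +-mono-≤ (≰⇒> p) (≰⇒> q) ⟩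
      M + M                             ≡⟨ cong (M +_) (sym (+-identityʳ M)) ⟩
      2 ^ (suc a + suc b)               ∎))
      where open ≤-Reasoning

    blueNbr : ∀ {y} → y ∈ᴸ Bs → y ∈ᴸ xs × x ≢ y × χ x y ≡ blue
    blueNbr y∈ = let y∈xs , eq = ∈-filter⁻ blue? y∈ in y∈xs , All-lookup x≢ y∈xs , eq

    redNbr : ∀ {y} → y ∈ᴸ Rs → y ∈ᴸ xs × x ≢ y × χ x y ≡ red
    redNbr y∈ = let y∈xs , neq = ∈-filter⁻ (¬? ∘ blue?) y∈ in
      y∈xs , All-lookup x≢ y∈xs , ≢blue⇒red neq

    fromBlue : M ≤ length Bs → Clique χ blue (suc a) (x ∷ xs) ⊎ Clique χ red (suc b) (x ∷ xs)
    fromBlue M≤ = Sum.map (clique-∷ blueNbr) (clique-⊆ (there ∘ proj₁ ∘ blueNbr))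
      (ramsey-cliques a (suc b) Bs (Unique-filter⁺ blue? uniq) M≤)

    fromRed : M ≤ length Rs → Clique χ blue (suc a) (x ∷ xs) ⊎ Clique χ red (suc b) (x ∷ xs)
    fromRed M≤ = Sum.map (clique-⊆ (there ∘ proj₁ ∘ redNbr)) (clique-∷ redNbr)
      (ramsey-cliques (suc a) b Rs (Unique-filter⁺ (¬? ∘ blue?) uniq)
        (subst (λ l → 2 ^ l ≤ length Rs) (+-suc a b) M≤))

clique⇒monoCopy : ∀ {n c} {χ : KColouring n} G {xs} → Symmetric χ →
                  Clique χ c (nV G) xs → MonoCopy χ c G
clique⇒monoCopy {c = c} {χ} G χ-sym (φ , _ , mono) =
  φ , injective-from-< (proj₁ ∘ mono) , λ e → coloured (loopless G e)
  where
  coloured : ∀ {i j} → i ≢ j → χ (φ i) (φ j) ≡ c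
  coloured {i} {j} i≢j with <-cmp i j
  ... | tri< i<j _ _ = proj₂ (mono i<j)
  ... | tri≈ _ i≡j _ = contradiction i≡j i≢j
  ... | tri> _ _ j<i = trans (χ-sym (φ i) (φ j)) (proj₂ (mono j<i))

ramsey : ∀ G₁ G₂ → RamseyProp G₁ G₂ (2 ^ (nV G₁ + nV G₂))
ramsey G₁ G₂ χ χ-sym = Sum.map (clique⇒monoCopy G₁ χ-sym) (clique⇒monoCopy G₂ χ-sym)
  (ramsey-cliques χ (nV G₁) (nV G₂) (allFin _) (allFin⁺ _) (≤-reflexive (sym (length-tabulate _))))

-- The complete graph as a hypergraph

AllPairs-lookup : ∀ {A : Set} {R : A → A → Set} {xs} → AllPairs R xs → ∀ {i j} → i <ᶠ j →
                  R (lookupᴸ xs i) (lookupᴸ xs j)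
AllPairs-lookup (Rx ∷ _) {zero} {suc j} _ = All-lookup Rx (∈-lookup j)
AllPairs-lookup (_ ∷ Rs) {suc i} {suc j} (s<s i<j) = AllPairs-lookup Rs i<j

∣p∪q∣≤∣p∣+∣q∣ : ∀ {n} (p q : Subset n) → ∣ p ∪ q ∣ ≤ ∣ p ∣ + ∣ q ∣
∣p∪q∣≤∣p∣+∣q∣ [] [] = z≤n
∣p∪q∣≤∣p∣+∣q∣ (false ∷ p) (false ∷ q) = ∣p∪q∣≤∣p∣+∣q∣ p q
∣p∪q∣≤∣p∣+∣q∣ (false ∷ p) (true ∷ q) = ≤-trans (s≤s (∣p∪q∣≤∣p∣+∣q∣ p q)) (≤-reflexive (sym (+-suc _ _)))
∣p∪q∣≤∣p∣+∣q∣ (true ∷ p) (false ∷ q) = s≤s (∣p∪q∣≤∣p∣+∣q∣ p q)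
∣p∪q∣≤∣p∣+∣q∣ (true ∷ p) (true ∷ q) = s≤s (≤-trans (∣p∪q∣≤∣p∣+∣q∣ p q) (+-monoʳ-≤ _ (n≤1+n _)))

pair : ∀ {n} → Fin n × Fin n → Subset n
pair (i , j) = ⁅ i ⁆ ∪ ⁅ j ⁆

∈-pair⁻ : ∀ {n} {x : Fin n} ij → x ∈ pair ij → x ≡ proj₁ ij ⊎ x ≡ proj₂ ij
∈-pair⁻ (i , j) x∈ = Sum.map (x∈⁅y⁆⇒x≡y i) (x∈⁅y⁆⇒x≡y j) (x∈p∪q⁻ ⁅ i ⁆ ⁅ j ⁆ x∈)

fst∈pair : ∀ {n} (ij : Fin n × Fin n) → proj₁ ij ∈ pair ij
fst∈pair (i , j) = x∈p∪q⁺ (inj₁ (x∈⁅x⁆ i))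

snd∈pair : ∀ {n} (ij : Fin n × Fin n) → proj₂ ij ∈ pair ij
snd∈pair (i , j) = x∈p∪q⁺ (inj₂ (x∈⁅x⁆ j))

-- Ordering the entries selects one representative for each two-element subset, so that `pair`
-- becomes injective.
Increasing : ∀ {n} → Fin n × Fin n → Set
Increasing (i , j) = i <ᶠ j

increasing? : ∀ {n} → Decidable (Increasing {n})
increasing? (i , j) = i <ᶠ? j

pair-injective : ∀ {n} {ij kl : Fin n × Fin n} → Increasing ij → Increasing kl →
                 pair ij ≡ pair kl → ij ≡ kl
pair-injective {ij = ij@(i , j)} {kl@(k , l)} i<j k<l eq
  with ∈-pair⁻ kl (subst (i ∈_) eq (fst∈pair ij)) | ∈-pair⁻ kl (subst (j ∈_) eq (snd∈pair ij))
... | inj₁ refl | inj₁ refl = contradiction i<j (<-irrefl refl)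
... | inj₁ refl | inj₂ refl = refl
... | inj₂ refl | inj₁ refl = contradiction i<j (<-asym k<l)
... | inj₂ refl | inj₂ refl = contradiction i<j (<-irrefl refl)

module _ (n : ℕ) where

  increasingPairs : List (Fin n × Fin n)
  increasingPairs = filter increasing? (cartesianProduct (allFin n) (allFin n))

  unique-increasingPairs : Unique increasingPairs
  unique-increasingPairs = Unique-filter⁺ increasing? (cartesianProduct⁺ (allFin⁺ n) (allFin⁺ n))

  increasing-lookup : ∀ i → Increasing (lookupᴸ increasingPairs i)
  increasing-lookup i = All-lookup (all-filter increasing? (cartesianProduct (allFin n) (allFin n))) (∈-lookup i)

  complete : ∀ {k} → 2 ≤ k → KHypergraph k n
  complete 2≤k = record
    { edge = pair ∘ lookupᴸ increasingPairs
    ; edge-inj = λ {i} {j} eq → injective-from-< (AllPairs-lookup unique-increasingPairs)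
        (pair-injective (increasing-lookup i) (increasing-lookup j) eq)
    ; size-pos = λ i → let (x , y) = lookupᴸ increasingPairs i in
        ≤-trans (≤-reflexive (sym (∣⁅x⁆∣≡1 x))) (∣p∣≤∣p∪q∣ ⁅ x ⁆ ⁅ y ⁆)
    ; size-le = λ i → let (x , y) = lookupᴸ increasingPairs i in
        ≤-trans (∣p∪q∣≤∣p∣+∣q∣ ⁅ x ⁆ ⁅ y ⁆)
          (≤-trans (≤-reflexive (cong₂ _+_ (∣⁅x⁆∣≡1 x) (∣⁅x⁆∣≡1 y))) 2≤k)
    }

  complete-covering : ∀ {k} (2≤k : 2 ≤ k) → Covering (complete 2≤k)
  complete-covering _ u v u≢v with <-cmp u v
  ... | tri≈ _ u≡v _ = contradiction u≡v u≢v
  ... | tri< u<v _ _ = index uv∈ ,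
          subst (λ ij → u ∈ pair ij) (lookup-index uv∈) (fst∈pair (u , v)) ,
          subst (λ ij → v ∈ pair ij) (lookup-index uv∈) (snd∈pair (u , v))
    where
    uv∈ : (u , v) ∈ᴸ increasingPairs
    uv∈ = ∈-filter⁺ increasing? (∈-cartesianProduct⁺ (∈-allFin u) (∈-allFin v)) u<v
  ... | tri> _ _ v<u = index vu∈ ,
          subst (λ ij → u ∈ pair ij) (lookup-index vu∈) (snd∈pair (v , u)) ,
          subst (λ ij → v ∈ pair ij) (lookup-index vu∈) (fst∈pair (v , u))
    where
    vu∈ : (v , u) ∈ᴸ increasingPairs
    vu∈ = ∈-filter⁺ increasing? (∈-cartesianProduct⁺ (∈-allFin v) (∈-allFin u)) v<u

coverGood⇒ramseyProp : ∀ {k} → 2 ≤ k → ∀ G₁ G₂ n → CoverGood k G₁ G₂ n → RamseyProp G₁ G₂ n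
coverGood⇒ramseyProp 2≤k G₁ G₂ n good χ χ-sym =
  Sum.map (monoCopy G₁) (monoCopy G₂)
    (good (complete n 2≤k) (complete-covering n 2≤k) pairColour)
  where
  pairColour : Fin (length (increasingPairs n)) → Colour
  pairColour i = let (x , y) = lookupᴸ (increasingPairs n) i in χ x y

  -- Two distinct members of a pair are its two entries in some order, and symmetry of `χ` absorbs
  -- the order.
  colour-pair : ∀ {x y} ij → x ≢ y → x ∈ pair ij → y ∈ pair ij → χ (proj₁ ij) (proj₂ ij) ≡ χ x y
  colour-pair ij x≢y x∈ y∈ with ∈-pair⁻ ij x∈ | ∈-pair⁻ ij y∈
  ... | inj₁ refl | inj₁ refl = contradiction refl x≢y
  ... | inj₁ refl | inj₂ refl = refl
  ... | inj₂ refl | inj₁ refl = χ-sym _ _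
  ... | inj₂ refl | inj₂ refl = contradiction refl x≢y

  monoCopy : ∀ {c} G → MonoBerge (complete n 2≤k) pairColour c G → MonoCopy χ c G
  monoCopy G (φ , f , φ-inj , _ , berge) = φ , φ-inj , λ e →
    let x∈ , y∈ , eq = berge e in
    trans (sym (colour-pair (lookupᴸ (increasingPairs n) (f e)) (loopless G e ∘ φ-inj) x∈ y∈)) eq

-- The greedy choice

⋃ᶠ : ∀ {s n} → (Fin s → Subset n) → Subset n
⋃ᶠ {zero} p = ⊥
⋃ᶠ {suc s} p = p zero ∪ ⋃ᶠ (p ∘ suc)

∈-⋃ᶠ : ∀ {s n x} (p : Fin s → Subset n) i → x ∈ p i → x ∈ ⋃ᶠ p
∈-⋃ᶠ p zero x∈ = x∈p∪q⁺ (inj₁ x∈)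
∈-⋃ᶠ p (suc i) x∈ = x∈p∪q⁺ (inj₂ (∈-⋃ᶠ (p ∘ suc) i x∈))

∪-size : ∀ {n a b} (p q : Subset n) → ∣ p ∣ ≤ a → ∣ q ∣ ≤ b → ∣ p ∪ q ∣ ≤ a + b
∪-size p q p≤ q≤ = ≤-trans (∣p∪q∣≤∣p∣+∣q∣ p q) (+-mono-≤ p≤ q≤)

⋃ᶠ-size : ∀ {s n b} (p : Fin s → Subset n) → (∀ i → ∣ p i ∣ ≤ b) → ∣ ⋃ᶠ p ∣ ≤ s * b
⋃ᶠ-size {zero} {n} p p≤ = ≤-reflexive (∣⊥∣≡0 n)
⋃ᶠ-size {suc s} p p≤ = ∪-size (p zero) _ (p≤ zero) (⋃ᶠ-size (p ∘ suc) (p≤ ∘ suc))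

∃-∉ : ∀ {n} (p : Subset n) → ∣ p ∣ < n → ∃ (_∉ p)
∃-∉ {n} p ∣p∣<n = ¬∀⟶∃¬ n (_∈ p) (_∈? p) λ all∈ →
  <⇒≱ ∣p∣<n (≤-trans (≤-reflexive (sym (∣⊤∣≡n n))) (p⊆q⇒∣p∣≤∣q∣ {p = ⊤} λ {x} _ → all∈ x))

-- Cardinalities as sums, and Markov's inequality

indicator : Bool → ℕ
indicator true = 1
indicator false = 0

size-tabulate : ∀ {n} (f : Fin n → Bool) → ∣ tabulate f ∣ ≡ sum (indicator ∘ f)
size-tabulate {zero} f = refl
size-tabulate {suc n} f with f zero
... | true = cong suc (size-tabulate (f ∘ suc))
... | false = size-tabulate (f ∘ suc)

size-lookup : ∀ {n} (p : Subset n) → ∣ p ∣ ≡ sum (indicator ∘ lookup p)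
size-lookup [] = refl
size-lookup (true ∷ p) = cong suc (size-lookup p)
size-lookup (false ∷ p) = size-lookup p

sum-≤ : ∀ {n b} (f : Fin n → ℕ) → (∀ i → f i ≤ b) → sum f ≤ n * b
sum-≤ {zero} f f≤ = z≤n
sum-≤ {suc n} f f≤ = +-mono-≤ (f≤ zero) (sum-≤ (f ∘ suc) (f≤ ∘ suc))

-- Every index satisfying `P` contributes at least `D` to the sum, and no index contributes
-- negatively.
markov : ∀ {n} D (g : Fin n → ℕ) {P : Fin n → Set} (P? : Decidable P) → (∀ {i} → P i → D ≤ g i) →
         D * ∣ tabulate (does ∘ P?) ∣ ≤ sum g
markov {zero} D g P? P⇒ = ≤-reflexive (*-zeroʳ D)
markov {suc n} D g P? P⇒ with P? zero
... | yes p = ≤-trans (≤-reflexive (*-suc D _)) (+-mono-≤ (P⇒ p) (markov D (g ∘ suc) (P? ∘ suc) P⇒))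
... | no _ = ≤-trans (markov D (g ∘ suc) (P? ∘ suc) P⇒) (m≤n+m _ _)

∈-tabulate⁺ : ∀ {n} (f : Fin n → Bool) {i} → f i ≡ true → i ∈ tabulate f
∈-tabulate⁺ f {i} eq = lookup⇒[]= i (tabulate f) (trans (lookup∘tabulate f i) eq)

-- Vertices whose pairs receive distinct edges

module Greedy {n k : ℕ} (E : Fin n → Fin n → Subset n) (∣E∣≤k : ∀ a b → ∣ E a b ∣ ≤ k) where

  -- E a b is the edge chosen for the pair ab (empty for a = b).
  W : Fin n → Fin n → Subset n
  W a b = tabulate λ z → lookup (E a z) b

  -- Double counting of the pairs (b, z) with `b ∈ E a z`.
  sum-∣W∣ : ∀ a → sum (λ b → ∣ W a b ∣) ≤ n * k
  sum-∣W∣ a = begin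
    sum (λ b → ∣ W a b ∣)                               ≡⟨ sum-cong-≗ {n} (λ b → size-tabulate (λ z → lookup (E a z) b)) ⟩
    sum (λ b → sum λ z → indicator (lookup (E a z) b))  ≡⟨ ∑-comm (λ b z → indicator (lookup (E a z) b)) ⟩
    sum (λ z → sum λ b → indicator (lookup (E a z) b))  ≡⟨ sum-cong-≗ {n} (λ z → sym (size-lookup (E a z))) ⟩
    sum (λ z → ∣ E a z ∣)                               ≤⟨ sum-≤ _ (∣E∣≤k a) ⟩
    n * k                                               ∎
    where open ≤-Reasoning

  -- v lists the vertices with the most recently chosen one first.  Only the
  -- edges E old new matter; mid∉ separates the edges of two pairs sharing
  -- their newest vertex, and new∉old all other pairs.
  record Spread {s} (v : Fin s → Fin n) : Set where
    field
      distinct : ∀ {i j} → i <ᶠ j → v i ≢ v j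
      new∉old  : ∀ {i j l} → i <ᶠ j → i <ᶠ l → v i ∉ E (v j) (v l)
      mid∉     : ∀ {i j l} → i <ᶠ j → j <ᶠ l → v j ∉ E (v l) (v i)

  spread-[] : Spread F.[]
  spread-[] = record { distinct = λ {} ; new∉old = λ {} ; mid∉ = λ {} }

  module _ (D : ℕ) where

    -- The newer vertex `v i` is not heavy for the older `v j`. This invariant guarantees that for
    -- such pairs `lightW` is all of `W`.
    Light : ∀ {s} → (Fin s → Fin n) → Set
    Light v = ∀ {i j} → i <ᶠ j → ∣ W (v j) (v i) ∣ ≤ D

    heavy : Fin n → Subset n
    heavy a = tabulate λ b → does (D <? ∣ W a b ∣)

    -- Cut down to the empty set for heavy pairs, so that `banned` can range over all index pairs in
    -- either order and still obey a uniform size bound.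
    lightW : Fin n → Fin n → Subset n
    lightW a b with ∣ W a b ∣ ≤? D
    ... | yes _ = W a b
    ... | no _  = ⊥

    lightW-size : ∀ a b → ∣ lightW a b ∣ ≤ D
    lightW-size a b with ∣ W a b ∣ ≤? D
    ... | yes le = le
    ... | no _   = ≤-trans (≤-reflexive (∣⊥∣≡0 n)) z≤n

    lightW-light : ∀ a b → ∣ W a b ∣ ≤ D → lightW a b ≡ W a b
    lightW-light a b le with ∣ W a b ∣ ≤? D
    ... | yes _ = refl
    ... | no ≰  = contradiction le ≰

    ∉heavy⇒light : ∀ {a b} → b ∉ heavy a → ∣ W a b ∣ ≤ D
    ∉heavy⇒light {a} {b} b∉ =
      ≮⇒≥ λ D<W → b∉ (∈-tabulate⁺ _ (dec-true (D <? ∣ W a b ∣) D<W))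

    banned : ∀ {s} → (Fin s → Fin n) → Subset n
    banned v = ⋃ᶠ λ i → ⁅ v i ⁆ ∪ (heavy (v i) ∪ ⋃ᶠ λ j → E (v i) (v j) ∪ lightW (v i) (v j))

    banned-size : ∀ {s h} (v : Fin s → Fin n) → (∀ a → ∣ heavy a ∣ ≤ h) →
                  ∣ banned v ∣ ≤ s * (1 + (h + s * (k + D)))
    banned-size v heavy≤ = ⋃ᶠ-size _ λ i →
      ∪-size ⁅ v i ⁆ _ (≤-reflexive (∣⁅x⁆∣≡1 (v i)))
        (∪-size (heavy (v i)) _ (heavy≤ (v i))
          (⋃ᶠ-size _ λ j → ∪-size (E (v i) (v j)) _ (∣E∣≤k _ _) (lightW-size _ _)))

    -- The new vertex gets index `zero`. Conditions involving it follow from one component of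
    -- `banned` each; all others are inherited from `v`.
    extend : ∀ {s z} (v : Fin s → Fin n) → z ∉ banned v →
             Spread v → Light v → Spread (z F.∷ v) × Light (z F.∷ v)
    extend {s} {z} v z∉ spread light =
      record { distinct = distinct′ ; new∉old = new∉old′ ; mid∉ = mid∉′ } , light′
      where
      open Spread spread

      z∉part : ∀ i → z ∉ ⁅ v i ⁆ ∪ (heavy (v i) ∪ ⋃ᶠ λ j → E (v i) (v j) ∪ lightW (v i) (v j))
      z∉part i z∈ = z∉ (∈-⋃ᶠ _ i z∈)

      z≢ : ∀ i → z ≢ v i
      z≢ i refl = z∉part i (x∈p∪q⁺ (inj₁ (x∈⁅x⁆ (v i))))

      z∉heavy : ∀ i → z ∉ heavy (v i)
      z∉heavy i z∈ = z∉part i (x∈p∪q⁺ (inj₂ (x∈p∪q⁺ (inj₁ z∈))))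

      z∉pair : ∀ i j → z ∉ E (v i) (v j) ∪ lightW (v i) (v j)
      z∉pair i j z∈ = z∉part i (x∈p∪q⁺ (inj₂ (x∈p∪q⁺ (inj₂ (∈-⋃ᶠ _ j z∈)))))

      z∉E : ∀ i j → z ∉ E (v i) (v j)
      z∉E i j z∈ = z∉pair i j (x∈p∪q⁺ (inj₁ z∈))

      -- Membership of `v j` in `E (v l) z` is the same as `z ∈ W (v l) (v j)`, and lightness of
      -- that pair puts this set inside `banned`.
      mid∉E : ∀ j l → j <ᶠ l → v j ∉ E (v l) z
      mid∉E j l j<l vj∈ = z∉pair l j (x∈p∪q⁺ (inj₂
        (subst (z ∈_) (sym (lightW-light _ _ (light j<l))) (∈-tabulate⁺ _ ([]=⇒lookup vj∈)))))

      v′ : Fin (suc s) → Fin n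
      v′ = z F.∷ v

      distinct′ : ∀ {i j} → i <ᶠ j → v′ i ≢ v′ j
      distinct′ {zero}  {suc j} _         = z≢ j
      distinct′ {suc i} {suc j} (s<s i<j) = distinct i<j

      new∉old′ : ∀ {i j l} → i <ᶠ j → i <ᶠ l → v′ i ∉ E (v′ j) (v′ l)
      new∉old′ {zero}  {suc j} {suc l} _         _         = z∉E j l
      new∉old′ {suc i} {suc j} {suc l} (s<s i<j) (s<s i<l) = new∉old i<j i<l

      mid∉′ : ∀ {i j l} → i <ᶠ j → j <ᶠ l → v′ j ∉ E (v′ l) (v′ i)
      mid∉′ {zero}  {suc j} {suc l} _         (s<s j<l) = mid∉E j l j<l
      mid∉′ {suc i} {suc j} {suc l} (s<s i<j) (s<s j<l) = mid∉ i<j j<l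

      light′ : Light v′
      light′ {zero}  {suc j} _         = ∉heavy⇒light (z∉heavy j)
      light′ {suc i} {suc j} (s<s i<j) = light i<j

    greedy : ∀ {h} → (∀ a → ∣ heavy a ∣ ≤ h) → ∀ r →
             (∀ {s} → s < r → s * (1 + (h + s * (k + D))) < n) →
             Σ (Fin r → Fin n) λ v → Spread v × Light v
    greedy heavy≤ zero _ = F.[] , spread-[] , λ {}
    greedy heavy≤ (suc r) room =
      let v , spread , light = greedy heavy≤ r (room ∘ m≤n⇒m≤1+n)
          z , z∉ = ∃-∉ (banned v) (≤-<-trans (banned-size v heavy≤) (room ≤-refl))
      in (z F.∷ v) , extend v z∉ spread light

  -- Heavy means strictly more than `D`, so each heavy vertex accounts for `suc D` in the sum
  -- bounded by `sum-∣W∣`. The factor `suc D` cancels even when `D` is zero.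
  heavy-size : ∀ {q} D → n ≤ q * suc D → ∀ a → ∣ heavy D a ∣ ≤ q * k
  heavy-size {q} D n≤ a = *-cancelˡ-≤ (suc D) (begin
    suc D * ∣ heavy D a ∣   ≤⟨ markov (suc D) (λ b → ∣ W a b ∣) (λ b → D <? ∣ W a b ∣) (λ D<W → D<W) ⟩
    sum (λ b → ∣ W a b ∣)   ≤⟨ sum-∣W∣ a ⟩
    n * k                   ≤⟨ *-monoˡ-≤ k n≤ ⟩
    q * suc D * k           ≡⟨ solve 3 (λ q d k → q :* d :* k := d :* (q :* k)) refl q (suc D) k ⟩
    suc D * (q * k)         ∎)
    where
    open ≤-Reasoning
    open +-*-Solver

  spread-exists : 1 ≤ k → ∀ r → 12 * k * r ^ 3 ≤ n → Σ (Fin r → Fin n) Spread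
  -- Split off so that the divisor `q` in the other case is nonzero.
  spread-exists 1≤k zero _ = F.[] , spread-[]
  spread-exists (s≤s {n = k′} z≤n) r@(suc r′) big =
    let v , spread , _ = greedy D (heavy-size {q} D n≤) r room in v , spread
    where
    open ≤-Reasoning
    open +-*-Solver

    q D : ℕ
    -- Since `D * q ≤ n`, at most r² light sets of size `D` cover at most a quarter of the vertices;
    -- since `n ≤ q * suc D`, each vertex has at most `q * k` heavy ones.
    q = 4 * (r * r)
    D = n / q

    n≤ : n ≤ q * suc D
    n≤ = begin
      n               ≡⟨ m≡m%n+[m/n]*n n q ⟩
      n % q + D * q   ≤⟨ +-monoˡ-≤ (D * q) (<⇒≤ (m%n<n n q)) ⟩
      suc D * q       ≡⟨ *-comm (suc D) q ⟩
      q * suc D       ∎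

    n>0 : 0 < n
    n>0 = ≤-trans z<s big

    room : ∀ {s} → s < r → s * (1 + (q * k + s * (k + D))) < n
    -- Scaling by 4 turns the light sets into `D * q ≤ n`. The remaining terms add up to at most 24
    -- `c`, and 12 `c` is at most n by `big`, so the total is at most 3 n, which is below 4 n. This
    -- fixes the constant 12.
    room {s} s<r = *-cancelˡ-< 4 _ _ (begin-strict
      4 * (s * (1 + (q * k + s * (k + D))))
        ≤⟨ *-monoʳ-≤ 4 (*-mono-≤ s≤r (s≤s (+-monoʳ-≤ (q * k) (*-monoˡ-≤ (k + D) s≤r)))) ⟩
      4 * (r * (1 + (q * k + r * (k + D))))
        ≡⟨ solve 3 (λ r k D →
             con 4 :* (r :* (con 1 :+ (con 4 :* (r :* r) :* k :+ r :* (k :+ D)))) :=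
             con 4 :* r :+ con 16 :* (k :* (r :* (r :* r))) :+ con 4 :* (r :* r :* k) :+ D :* (con 4 :* (r :* r)))
             refl r k D ⟩
      4 * r + 16 * c + 4 * (r * r * k) + D * q
        ≤⟨ +-mono-≤ (+-mono-≤ (+-monoˡ-≤ (16 * c) (*-monoʳ-≤ 4 r≤c)) (*-monoʳ-≤ 4 rrk≤c)) (m/n*n≤m n q) ⟩
      4 * c + 16 * c + 4 * c + n
        ≡⟨ solve 3 (λ r k n → let c = k :* (r :* (r :* r)) in
             con 4 :* c :+ con 16 :* c :+ con 4 :* c :+ n :=
             con 2 :* (con 12 :* k :* (r :* (r :* (r :* con 1)))) :+ n) refl r k n ⟩
      2 * (12 * k * r ^ 3) + n
        ≤⟨ +-monoˡ-≤ n (*-monoʳ-≤ 2 big) ⟩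
      2 * n + n
        <⟨ m<m+n (2 * n + n) n>0 ⟩
      2 * n + n + n
        ≡⟨ solve 1 (λ n → con 2 :* n :+ n :+ n := con 4 :* n) refl n ⟩
      4 * n ∎)
      where
      c : ℕ
      c = k * (r * (r * r))

      s≤r : s ≤ r
      s≤r = <⇒≤ s<r

      r≤c : r ≤ c
      r≤c = ≤-trans (m≤m*n r (r * r)) (m≤n*m (r * (r * r)) k)

      rrk≤c : r * r * k ≤ c
      rrk≤c = ≤-trans (≤-reflexive (*-comm (r * r) k)) (*-monoʳ-≤ k (m≤n*m (r * r) r))

-- From spread vertices to Berge copies

module _ {k n : ℕ} (H : KHypergraph k n) (cov : Covering H) where

  -- `cov` may answer differently for the two orders of a pair and for different proofs of `a ≢ b`.
  -- Taking the proof from `≟ᶠ` makes the edge a function of the ordered pair alone.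
  linkEdge : Fin n → Fin n → Subset n
  linkEdge a b with a ≟ᶠ b
  ... | yes _  = ⊥
  ... | no a≢b = edge H (proj₁ (cov a b a≢b))

  linkEdge-size : ∀ a b → ∣ linkEdge a b ∣ ≤ k
  linkEdge-size a b with a ≟ᶠ b
  ... | yes _ = ≤-trans (≤-reflexive (∣⊥∣≡0 n)) z≤n
  ... | no _  = size-le H _

  link : ∀ {a b} → a ≢ b → ∃ λ i → edge H i ≡ linkEdge a b × a ∈ edge H i × b ∈ edge H i
  link {a} {b} a≢b with a ≟ᶠ b
  ... | yes a≡b = contradiction a≡b a≢b
  ... | no a≢b′ = let i , a∈ , b∈ = cov a b a≢b′ in i , refl , a∈ , b∈

  open Greedy linkEdge linkEdge-size using (Spread)

  module _ {r} {v : Fin r → Fin n} (spread : Spread v) where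
    open Spread spread

    pairLink : ∀ {i j} → i <ᶠ j →
               ∃ λ l → edge H l ≡ linkEdge (v j) (v i) × v j ∈ edge H l × v i ∈ edge H l
    pairLink i<j = link (distinct i<j ∘ sym)

    old∈ : ∀ {i j} (p : i <ᶠ j) → v j ∈ edge H (proj₁ (pairLink p))
    old∈ p = proj₁ (proj₂ (proj₂ (pairLink p)))

    new∈ : ∀ {i j} (p : i <ᶠ j) → v i ∈ edge H (proj₁ (pairLink p))
    new∈ p = proj₂ (proj₂ (proj₂ (pairLink p)))

    transfer : ∀ {i j i′ j′ x} (p : i <ᶠ j) (p′ : i′ <ᶠ j′) → proj₁ (pairLink p) ≡ proj₁ (pairLink p′) →
               x ∈ edge H (proj₁ (pairLink p)) → x ∈ linkEdge (v j′) (v i′)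
    transfer p p′ eq = subst (_ ∈_) (trans (cong (edge H) eq) (proj₁ (proj₂ (pairLink p′))))

    -- If the newest vertices of the two pairs differ, the newer of them lies in the edge of a pair
    -- of older vertices, against `new∉old`. If they coincide, the middle vertex lies in the edge of
    -- the other two, against `mid∉`.
    pairLink-injective : ∀ {i j i′ j′} (p : i <ᶠ j) (p′ : i′ <ᶠ j′) →
                         proj₁ (pairLink p) ≡ proj₁ (pairLink p′) → i ≡ i′ × j ≡ j′
    pairLink-injective {i} {j} {i′} {j′} p p′ eq with <-cmp i i′
    ... | tri< i<i′ _ _ = contradiction (transfer p p′ eq (new∈ p)) (new∉old (<ᶠ-trans i<i′ p′) i<i′)
    ... | tri> _ _ i′<i = contradiction (transfer p′ p (sym eq) (new∈ p′)) (new∉old (<ᶠ-trans i′<i p) i′<i)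
    ... | tri≈ _ refl _ with <-cmp j j′
    ...   | tri< j<j′ _ _ = contradiction (transfer p p′ eq (old∈ p)) (mid∉ p j<j′)
    ...   | tri≈ _ j≡j′ _ = refl , j≡j′
    ...   | tri> _ _ j′<j = contradiction (transfer p′ p (sym eq) (old∈ p′)) (mid∉ p′ j′<j)

    module _ (χ : HColouring H) where

      linkColouring : KColouring r
      linkColouring i j with <-cmp i j
      ... | tri< i<j _ _ = χ (proj₁ (pairLink i<j))
      -- An arbitrary value on the diagonal: copies of loopless graphs under injective maps never
      -- read it.
      ... | tri≈ _ _ _   = blue
      ... | tri> _ _ j<i = χ (proj₁ (pairLink j<i))

      linkColouring-sym : Symmetric linkColouring
      linkColouring-sym i j with <-cmp i j | <-cmp j i
      -- The two comparisons return separate proofs of one inequality, and `pairLink` takes the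
      -- proof as an argument.
      ... | tri< p _ _   | tri> _ _ p′  = cong (χ ∘ proj₁ ∘ pairLink) (<ᶠ-irrelevant p p′)
      ... | tri> _ _ p   | tri< p′ _ _  = cong (χ ∘ proj₁ ∘ pairLink) (<ᶠ-irrelevant p p′)
      ... | tri≈ _ _ _   | tri≈ _ _ _   = refl
      ... | tri< p _ _   | tri< _ _ ¬p  = contradiction p ¬p
      ... | tri< _ i≢j _ | tri≈ _ j≡i _ = contradiction (sym j≡i) i≢j
      ... | tri≈ _ i≡j _ | tri< _ j≢i _ = contradiction (sym i≡j) j≢i
      ... | tri≈ _ i≡j _ | tri> _ j≢i _ = contradiction (sym i≡j) j≢i
      ... | tri> _ i≢j _ | tri≈ _ j≡i _ = contradiction (sym j≡i) i≢j
      ... | tri> _ _ p   | tri> ¬p _ _  = contradiction p ¬p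

      -- Remembers that `l` was chosen for the unordered pair of `i` and `j`, so that the pair can
      -- be recovered from `l`.
      IsPairLink : Fin r → Fin r → Fin (m H) → Set
      IsPairLink i j l = (Σ (i <ᶠ j) λ p → l ≡ proj₁ (pairLink p)) ⊎
                         (Σ (j <ᶠ i) λ p → l ≡ proj₁ (pairLink p))

      colouredLink : ∀ {c i j} → i ≢ j → linkColouring i j ≡ c →
                     ∃ λ l → (v i ∈ edge H l × v j ∈ edge H l × χ l ≡ c) × IsPairLink i j l
      colouredLink {i = i} {j} i≢j eq with <-cmp i j
      ... | tri< p _ _ = let l , _ , vj∈ , vi∈ = pairLink p in l , (vi∈ , vj∈ , eq) , inj₁ (p , refl)
      ... | tri≈ _ i≡j _ = contradiction i≡j i≢j
      ... | tri> _ _ p = let l , _ , vi∈ , vj∈ = pairLink p in l , (vi∈ , vj∈ , eq) , inj₂ (p , refl)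

      -- Reduces to `pairLink-injective` after sorting both pairs. The two alternatives have the
      -- shape of the hypothesis of `simple`, which then identifies the graph edges.
      isPairLink-injective : ∀ {i j i′ j′ l} → IsPairLink i j l → IsPairLink i′ j′ l →
                             (i ≡ i′ × j ≡ j′) ⊎ (i ≡ j′ × j ≡ i′)
      isPairLink-injective (inj₁ (p , eq)) (inj₁ (p′ , eq′)) =
        inj₁ (pairLink-injective p p′ (trans (sym eq) eq′))
      isPairLink-injective (inj₁ (p , eq)) (inj₂ (p′ , eq′)) =
        inj₂ (pairLink-injective p p′ (trans (sym eq) eq′))
      isPairLink-injective (inj₂ (p , eq)) (inj₁ (p′ , eq′)) =
        inj₂ (swap (pairLink-injective p p′ (trans (sym eq) eq′)))
      isPairLink-injective (inj₂ (p , eq)) (inj₂ (p′ , eq′)) =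
        inj₁ (swap (pairLink-injective p p′ (trans (sym eq) eq′)))

      monoCopy⇒monoBerge : ∀ {c} G → MonoCopy linkColouring c G → MonoBerge H χ c G
      monoCopy⇒monoBerge {c} G (φ , φ-inj , mono) =
        v ∘ φ , proj₁ ∘ chosen , φ-inj ∘ injective-from-< distinct , f-inj , λ e → proj₁ (proj₂ (chosen e))
        where
        chosen : ∀ e → ∃ λ l → (v (φ (end₁ G e)) ∈ edge H l × v (φ (end₂ G e)) ∈ edge H l × χ l ≡ c) ×
                               IsPairLink (φ (end₁ G e)) (φ (end₂ G e)) l
        chosen e = colouredLink (loopless G e ∘ φ-inj) (mono e)

        f-inj : Injective _≡_ _≡_ (proj₁ ∘ chosen)
        f-inj {e} {e′} eq = simple G e e′
          (Sum.map (Product.map φ-inj φ-inj) (Product.map φ-inj φ-inj)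
            (isPairLink-injective (proj₂ (proj₂ (chosen e)))
              (subst (IsPairLink _ _) (sym eq) (proj₂ (proj₂ (chosen e′))))))

-- Both bounds combined

ramseyProp⇒coverThreshold : ∀ {k} → 1 ≤ k → ∀ G₁ G₂ r → RamseyProp G₁ G₂ r →
                            CoverThreshold k G₁ G₂ (12 * k * r ^ 3)
ramseyProp⇒coverThreshold 1≤k G₁ G₂ r prop n big H cov χ =
  Sum.map (monoCopy⇒monoBerge H cov spread χ G₁) (monoCopy⇒monoBerge H cov spread χ G₂)
    (prop (linkColouring H cov spread χ) (linkColouring-sym H cov spread χ))
  where
  open Greedy (linkEdge H cov) (linkEdge-size H cov)
  spread : Spread _
  spread = proj₂ (spread-exists 1≤k r big)

theorem1 : ∀ (k : ℕ) → 2 ≤ k →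
    ∃ λ (c : ℕ) → ∀ (G₁ G₂ : Graph) → NonEmpty G₁ → NonEmpty G₂ →
    Σ ℕ λ r → Σ ℕ λ h →
    IsRamseyNumber G₁ G₂ r × IsCoverRamseyNumber k G₁ G₂ h ×
    r ≤ h × h ≤ c * r ^ 3
theorem1 k 2≤k = 12 * k , λ G₁ G₂ _ _ →
  let r , isR@(ramsey-r , r-min) = least (ramseyProp? G₁ G₂) _ (ramsey G₁ G₂)
      h , isH@(threshold-h , _) , h≤ = least-threshold (coverGood? k G₁ G₂) _
        (ramseyProp⇒coverThreshold (≤-trans (n≤1+n 1) 2≤k) G₁ G₂ r ramsey-r)
  in r , h , isR , isH ,
     -- Being a threshold, `h` is itself a good order, so `h` has the Ramsey property and minimality
     -- of `r` applies.
     r-min h (coverGood⇒ramseyProp 2≤k G₁ G₂ h (threshold-h h ≤-refl)) , h≤
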